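{- Let $G$ be a graph and $v\in V(G)$. If $\gamma_{st}(G-v)=\gamma_{st}(G)$, then \[ \operatorname{st}_{\gamma_{st}}(G)\le \operatorname{st}_{\gamma_{st}}(G-v)+1 . \]
   Context: All graphs are finite, simple and undirected. For a graph $G=(V,E)$, a set $D\subseteq V$ is a strong dominating set if every vertex $v\in V\setminus D$ is adjacent to some $u\in D$ with $\deg(v)\le\deg(u)$ (degrees taken in $G$). The strong domination number $\gamma_{st}(G)$ is the minimum size of a strong dominating set; the graph with no vertices has $\gamma_{st}=0$. For $S\subseteq V$, $G-S$ is the graph obtained by deleting the vertices of $S$, and $G-v=G-\{v\}$. The stability of the strong domination number is $\operatorname{st}_{\gamma_{st}}(G)=\min\{|S| : S\subseteq V,\ \gamma_{st}(G-S)\ne\gamma_{st}(G)\}$ (the choice $S=V$ is allowed, so that $\operatorname{st}_{\gamma_{st}}(K_n)=n$). -}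

module Defs where

open import Data.Fin.Base using (Fin)
open import Data.Fin.Properties using (all?; any?)
open import Data.Fin.Subset using (Subset; inside; outside; _∈_; _∉_; _⊆_; _─_; ⁅_⁆; ∣_∣)
open import Data.Fin.Subset.Properties using (_∈?_; _⊆?_; x∈p∧x∉q⇒x∈p─q)
open import Data.List.Base as List using (List; []; _∷_; _++_)
open import Data.List.Extrema.Nat using (min)
open import Data.Nat.Base using (ℕ; zero; suc; _≤_)
open import Data.Nat.Properties using (_≤?_; _≟_)
open import Data.Product.Base using (∃; _×_; _,_)
open import Data.Vec.Base as Vec using ()
open import Level using (0ℓ)
open import Relation.Binary.Core using (Rel)
open import Relation.Binary.Definitions using (Symmetric)
import Relation.Binary.Definitions as Binary
open import Relation.Binary.PropositionalEquality.Core using (_≡_; _≢_)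
open import Relation.Nullary.Decidable using (¬?; _×-dec_; _→-dec_)
open import Relation.Nullary.Negation using (¬_)
open import Relation.Unary using (Pred; Decidable)

-- The vertex set is a subset of an ambient Fin n, so that deleting vertices
-- stays within Graph n and needs no relabelling.  Elements of Fin n outside V
-- are not vertices, and by ~⇒∈V they have no incident edges.
record Graph (n : ℕ) : Set₁ where
  infix 4 _~_ _~?_
  field
    V        : Subset n
    _~_      : Rel (Fin n) 0ℓ
    _~?_     : Binary.Decidable _~_
    ~-sym    : Symmetric _~_
    ~-irrefl : ∀ {x} → ¬ (x ~ x)
    ~⇒∈V     : ∀ {x y} → x ~ y → x ∈ V

  deg : Fin n → ℕ
  deg x = Vec.count (x ~?_) (Vec.allFin n)

open Graph public using (V; deg)

infixl 5 _∖_ _∖ᵥ_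

_∖_ : ∀ {n} → Graph n → Subset n → Graph n
G ∖ S = record
  { V        = V G ─ S
  ; _~_      = λ x y → x ∉ S × y ∉ S × x ~ y
  ; _~?_     = λ x y → ¬? (x ∈? S) ×-dec ¬? (y ∈? S) ×-dec (x ~? y)
  ; ~-sym    = λ (x∉S , y∉S , x~y) → y∉S , x∉S , ~-sym x~y
  ; ~-irrefl = λ (_ , _ , x~x) → ~-irrefl x~x
  ; ~⇒∈V     = λ (x∉S , _ , x~y) → x∈p∧x∉q⇒x∈p─q (~⇒∈V x~y) x∉S
  }
  where open Graph G using (_~_; _~?_; ~-sym; ~-irrefl; ~⇒∈V)

_∖ᵥ_ : ∀ {n} → Graph n → Fin n → Graph n
G ∖ᵥ v = G ∖ ⁅ v ⁆

allSubsets : ∀ n → List (Subset n)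
allSubsets zero    = Vec.[] ∷ []
allSubsets (suc n) = List.map (inside Vec.∷_) (allSubsets n)
                  ++ List.map (outside Vec.∷_) (allSubsets n)

-- The minimum of d and of the sizes of all subsets satisfying P.
minSize : ∀ {n} {P : Pred (Subset n) 0ℓ} → ℕ → Decidable P → ℕ
minSize {n} d P? = min d (List.map ∣_∣ (List.filter P? (allSubsets n)))

module _ {n} (G : Graph n) where
  open Graph G using (_~_; _~?_)

  StrongDominating : Pred (Subset n) 0ℓ
  StrongDominating D =
    D ⊆ V G ×
    (∀ v → v ∈ V G → v ∉ D → ∃ λ u → u ∈ D × v ~ u × deg G v ≤ deg G u)

  strongDominating? : Decidable StrongDominating
  strongDominating? D =
    (D ⊆? V G) ×-dec
    all? (λ v → (v ∈? V G) →-dec (¬? (v ∈? D) →-dec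
      any? (λ u → (u ∈? D) ×-dec (v ~? u) ×-dec (deg G v ≤? deg G u))))

-- The default ∣ V G ∣ does not affect the minimum, as V G itself is a strong
-- dominating set.
γst : ∀ {n} → Graph n → ℕ
γst G = minSize ∣ V G ∣ (strongDominating? G)

module _ {n} (G : Graph n) where

  ChangesγSt : Pred (Subset n) 0ℓ
  ChangesγSt S = S ⊆ V G × γst (G ∖ S) ≢ γst G

  changesγSt? : Decidable ChangesγSt
  changesγSt? S = (S ⊆? V G) ×-dec ¬? (γst (G ∖ S) ≟ γst G)

-- If G has a vertex, then S = V G changes γst (to 0), so the default ∣ V G ∣
-- does not affect the minimum.  If G has no vertices, no S changes γst, and the
-- otherwise undefined minimum is set to 0.
stγst : ∀ {n} → Graph n → ℕ
stγst G = minSize ∣ V G ∣ (changesγSt? G)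

{-# OPTIONS --safe #-}

-- If S changes γst of G − v, then {v} ∪ S changes γst of G, because
-- G − ({v} ∪ S) = (G − v) − S and γst (G − v) = γst G.

module Submission where

open import Defs
open import Data.Nat.Base using (ℕ; _≤_; _+_; z≤n; s≤s; suc)
open import Data.Nat.Properties
  using (≤-trans; +-suc; +-comm; m≤n⇒m≤1+n; module ≤-Reasoning)
open import Data.Bool.Base using (if_then_else_)
open import Data.Fin.Base using (Fin)
open import Data.Fin.Subset using (Subset; inside; outside; _∈_; _∪_; _─_; ⁅_⁆; ∣_∣)
open import Data.Fin.Subset.Properties
  using (_∈?_; x∈p∪q⁺; x∈p∪q⁻; x∈p∧x∉q⇒x∈p─q; x∈⁅y⁆⇒x≡y; p─q⊆p; p─q─r≡p─q∪r;
         p⊆q⇒∣p∣≤∣q∣; ∣⁅x⁆∣≡1)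
open import Data.List.Base as List using (List)
open import Data.List.Extrema.Nat using (min; min≤⊤; min≤xs; argmin-all)
open import Data.List.Membership.Propositional using () renaming (_∈_ to _∈ᴸ_)
open import Data.List.Membership.Propositional.Properties
  using (∈-map⁺; ∈-filter⁺; ∈-++⁺ˡ; ∈-++⁺ʳ)
open import Data.List.Properties using (filter-≐)
open import Data.List.Relation.Unary.All using (lookup; map)
open import Data.List.Relation.Unary.All.Properties using (map⁺; all-filter)
open import Data.List.Relation.Unary.Any using (here)
open import Data.Product.Base using (_,_)
open import Data.Sum.Base using (inj₁; inj₂; [_,_]′)
open import Data.Vec.Base using (Vec; []; _∷_; count; allFin)
open import Function.Base using (id; _∘_)
open import Function.Bundles using (_⇔_; mk⇔; module Equivalence)
open import Level using (Level; 0ℓ)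
open import Relation.Binary.PropositionalEquality.Core
  using (_≡_; refl; sym; trans; cong; cong₂; subst; subst₂)
open import Relation.Nullary.Decidable using (yes; no; does-⇔)
open import Relation.Unary using (Pred; Decidable; _≐_)

-- Take `S` attaining `stγst (G ∖ᵥ v)`. Deleting `⁅ v ⁆ ∪ S` from `G` leaves the same graph as
-- deleting `S` from `G ∖ᵥ v`, and the hypothesis makes the reference values `γst G` and
-- `γst (G ∖ᵥ v)` equal, so the union changes `γst G` at the cost of at most one more vertex. Two
-- points carry this. The two iterated deletions have logically equivalent but not identical
-- adjacency relations, so `γst` must be shown invariant under such equivalence (`γst-cong`,
-- `γst-∖-∪`). And a `minSize` may be its default, so the bound is also checked there
-- (`minSize-elim`).

private
  variable
    a p q : Level
    A : Set a
    n : ℕ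

-- `count` sees only the Boolean of each decision, and equivalent predicates have equal Booleans.
-- Degrees thus agree across equivalent adjacency relations.
count-cong : {P : Pred A p} {Q : Pred A q} (P? : Decidable P) (Q? : Decidable Q) →
  (∀ x → P x ⇔ Q x) → (xs : Vec A n) → count P? xs ≡ count Q? xs
count-cong P? Q? P⇔Q []       = refl
count-cong P? Q? P⇔Q (x ∷ xs) =
  cong₂ (λ b → if b then suc else id) (does-⇔ (P⇔Q x) (P? x) (Q? x)) (count-cong P? Q? P⇔Q xs)

∣p∪q∣≤∣p∣+∣q∣ : (p q : Subset n) → ∣ p ∪ q ∣ ≤ ∣ p ∣ + ∣ q ∣
∣p∪q∣≤∣p∣+∣q∣ []            []            = z≤n
∣p∪q∣≤∣p∣+∣q∣ (outside ∷ p) (outside ∷ q) = ∣p∪q∣≤∣p∣+∣q∣ p q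
∣p∪q∣≤∣p∣+∣q∣ (outside ∷ p) (inside  ∷ q) rewrite +-suc ∣ p ∣ ∣ q ∣ = s≤s (∣p∪q∣≤∣p∣+∣q∣ p q)
∣p∪q∣≤∣p∣+∣q∣ (inside  ∷ p) (outside ∷ q) = s≤s (∣p∪q∣≤∣p∣+∣q∣ p q)
-- A shared element counts once on the left and twice on the right, hence the weakening.
∣p∪q∣≤∣p∣+∣q∣ (inside  ∷ p) (inside  ∷ q) rewrite +-suc ∣ p ∣ ∣ q ∣ =
  s≤s (m≤n⇒m≤1+n (∣p∪q∣≤∣p∣+∣q∣ p q))

∣⁅x⁆∪p∣≤∣p∣+1 : (x : Fin n) (p : Subset n) → ∣ ⁅ x ⁆ ∪ p ∣ ≤ ∣ p ∣ + 1
∣⁅x⁆∪p∣≤∣p∣+1 x p = begin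
  ∣ ⁅ x ⁆ ∪ p ∣      ≤⟨ ∣p∪q∣≤∣p∣+∣q∣ ⁅ x ⁆ p ⟩
  ∣ ⁅ x ⁆ ∣ + ∣ p ∣  ≡⟨ cong (_+ ∣ p ∣) (∣⁅x⁆∣≡1 x) ⟩
  1 + ∣ p ∣          ≡⟨ +-comm 1 ∣ p ∣ ⟩
  ∣ p ∣ + 1          ∎
  where open ≤-Reasoning

∣p∣≤∣p─⁅x⁆∣+1 : (p : Subset n) (x : Fin n) → ∣ p ∣ ≤ ∣ p ─ ⁅ x ⁆ ∣ + 1
∣p∣≤∣p─⁅x⁆∣+1 p x = begin
  ∣ p ∣                    ≤⟨ p⊆q⇒∣p∣≤∣q∣ split ⟩
  ∣ ⁅ x ⁆ ∪ (p ─ ⁅ x ⁆) ∣  ≤⟨ ∣⁅x⁆∪p∣≤∣p∣+1 x (p ─ ⁅ x ⁆) ⟩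
  ∣ p ─ ⁅ x ⁆ ∣ + 1        ∎
  where
  open ≤-Reasoning
  split : ∀ {y} → y ∈ p → y ∈ ⁅ x ⁆ ∪ (p ─ ⁅ x ⁆)
  split {y} y∈p with y ∈? ⁅ x ⁆
  ... | yes y∈⁅x⁆ = x∈p∪q⁺ (inj₁ y∈⁅x⁆)
  ... | no  y∉⁅x⁆ = x∈p∪q⁺ (inj₂ (x∈p∧x∉q⇒x∈p─q y∈p y∉⁅x⁆))

∈-allSubsets : (p : Subset n) → p ∈ᴸ allSubsets n
∈-allSubsets []            = here refl
∈-allSubsets (inside  ∷ p) = ∈-++⁺ˡ (∈-map⁺ _ (∈-allSubsets p))
∈-allSubsets (outside ∷ p) = ∈-++⁺ʳ _ (∈-map⁺ _ (∈-allSubsets p))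

module _ {P : Pred (Subset n) 0ℓ} (P? : Decidable P) where
  private
    sizes : List ℕ
    sizes = List.map ∣_∣ (List.filter P? (allSubsets n))

  minSize≤default : ∀ d → minSize d P? ≤ d
  minSize≤default d = min≤⊤ d sizes

  minSize≤∣p∣ : ∀ d {p} → P p → minSize d P? ≤ ∣ p ∣
  minSize≤∣p∣ d {p} Pp =
    lookup (min≤xs d sizes) (∈-map⁺ ∣_∣ (∈-filter⁺ P? (∈-allSubsets p) Pp))

  -- The minimum is either the default or the size of some subset satisfying `P`, so these two cases
  -- decide any property of it.
  minSize-elim : (Q : Pred ℕ q) → ∀ {d} → Q d → (∀ {p} → P p → Q ∣ p ∣) → Q (minSize d P?)
  minSize-elim Q Qd Q∣∣ =
    argmin-all id {P = Q} Qd (map⁺ (map Q∣∣ (all-filter P? (allSubsets n))))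

minSize-cong : {P Q : Pred (Subset n) 0ℓ} (P? : Decidable P) (Q? : Decidable Q) →
  P ≐ Q → ∀ {d e} → d ≡ e → minSize d P? ≡ minSize e Q?
minSize-cong {n = n} P? Q? P≐Q {d} refl =
  cong (min d ∘ List.map ∣_∣) (filter-≐ P? Q? P≐Q (allSubsets n))

module _ (G H : Graph n) where
  private
    module G = Graph G
    module H = Graph H

  deg-cong : (∀ {x y} → x G.~ y ⇔ x H.~ y) → ∀ x → deg G x ≡ deg H x
  deg-cong ~⇔ x = count-cong (x G.~?_) (x H.~?_) (λ _ → ~⇔) (allFin n)

  StrongDominating-resp : V G ≡ V H → (∀ {x y} → x G.~ y ⇔ x H.~ y) →
    ∀ {D} → StrongDominating G D → StrongDominating H D
  StrongDominating-resp V≡ ~⇔ {D} (D⊆V , dom) =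
    subst (_ ∈_) V≡ ∘ D⊆V ,
    λ v v∈V v∉D →
      let u , u∈D , v~u , deg≤ = dom v (subst (v ∈_) (sym V≡) v∈V) v∉D
      in u , u∈D , Equivalence.to ~⇔ v~u , subst₂ _≤_ (deg-cong ~⇔ v) (deg-cong ~⇔ u) deg≤

γst-cong : (G H : Graph n) → V G ≡ V H →
  (∀ {x y} → Graph._~_ G x y ⇔ Graph._~_ H x y) → γst G ≡ γst H
γst-cong G H V≡ ~⇔ =
  minSize-cong (strongDominating? G) (strongDominating? H)
    ( StrongDominating-resp G H V≡ ~⇔
    , StrongDominating-resp H G (sym V≡) (mk⇔ (Equivalence.from ~⇔) (Equivalence.to ~⇔)))
    (cong ∣_∣ V≡)

-- Vertex sets agree by the law for iterated difference; adjacencies agree because avoiding `S ∪ T`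
-- means avoiding both `S` and `T`.
γst-∖-∪ : (G : Graph n) (S T : Subset n) → γst (G ∖ S ∖ T) ≡ γst (G ∖ (S ∪ T))
γst-∖-∪ G S T = γst-cong (G ∖ S ∖ T) (G ∖ (S ∪ T)) (p─q─r≡p─q∪r (V G) S T) (mk⇔
  (λ (x∉T , y∉T , x∉S , y∉S , x~y) →
    [ x∉S , x∉T ]′ ∘ x∈p∪q⁻ S T , [ y∉S , y∉T ]′ ∘ x∈p∪q⁻ S T , x~y)
  (λ (x∉ , y∉ , x~y) →
    x∉ ∘ x∈p∪q⁺ ∘ inj₂ , y∉ ∘ x∈p∪q⁺ ∘ inj₂ , x∉ ∘ x∈p∪q⁺ ∘ inj₁ , y∉ ∘ x∈p∪q⁺ ∘ inj₁ , x~y))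

ChangesγSt-∪ : (G : Graph n) {v : Fin n} {S : Subset n} → v ∈ V G → γst (G ∖ᵥ v) ≡ γst G →
  ChangesγSt (G ∖ᵥ v) S → ChangesγSt G (⁅ v ⁆ ∪ S)
ChangesγSt-∪ G {v} {S} v∈V γ≡ (S⊆V-v , γ≢) =
  [ (λ x∈⁅v⁆ → subst (_∈ V G) (sym (x∈⁅y⁆⇒x≡y v x∈⁅v⁆)) v∈V)
  , p─q⊆p (V G) ⁅ v ⁆ ∘ S⊆V-v ]′ ∘ x∈p∪q⁻ ⁅ v ⁆ S ,
  -- An unchanged value for the union would pass through `γ≡` to an unchanged value for `S` in
  -- `G ∖ᵥ v`.
  λ γ∪≡ → γ≢ (trans (γst-∖-∪ G ⁅ v ⁆ S) (trans γ∪≡ (sym γ≡)))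

theorem3p3 : ∀ {n : ℕ} (G : Graph n) (v : Fin n) → v ∈ V G →
    γst (G ∖ᵥ v) ≡ γst G →
    stγst G ≤ stγst (G ∖ᵥ v) + 1
theorem3p3 G v v∈V γ≡ =
  minSize-elim (changesγSt? (G ∖ᵥ v)) (λ m → stγst G ≤ m + 1)
    -- Default case: `stγst G` is at most its own default, and the two vertex counts differ by at
    -- most one.
    (≤-trans (minSize≤default (changesγSt? G) ∣ V G ∣) (∣p∣≤∣p─⁅x⁆∣+1 (V G) v))
    -- Witness case: `⁅ v ⁆ ∪ S` competes in the minimum defining `stγst G`.
    (λ {S} changes → ≤-trans
      (minSize≤∣p∣ (changesγSt? G) ∣ V G ∣ (ChangesγSt-∪ G v∈V γ≡ changes))
      (∣⁅x⁆∪p∣≤∣p∣+1 v S))
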